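{- Let $\mathcal{H}, \mathcal{H}_1, \mathcal{H}_2$ be hypergraphs such that $\mathcal{H} \to^* \mathcal{H}_1$ and $\mathcal{H} \to^* \mathcal{H}_2$, i.e., $\mathcal{H}_1$ and $\mathcal{H}_2$ are each obtained from $\mathcal{H}$ by a (possibly empty) finite sequence of applications of the edge-domination and node-domination rules. Then there exist hypergraphs $\mathcal{H}_1'$ and $\mathcal{H}_2'$ such that $\mathcal{H}_1 \to^* \mathcal{H}_1'$, $\mathcal{H}_2 \to^* \mathcal{H}_2'$, and $\mathcal{H}_1'$ is isomorphic to $\mathcal{H}_2'$.
   Context: A hypergraph is a triple $\mathcal{H} = (V,E,I)$ where $V$ is a finite set (of nodes), $E$ is a finite set (of hyperedges, or edges), and $I \subseteq V \times E$ is a binary relation (the incidence relation). Distinct edges may be incident to the same set of nodes. For $v \in V$ let $E(v) = \{e \in E : (v,e) \in I\}$, and for $e \in E$ let $V(e) = \{v \in V : (v,e) \in I\}$. Edge-domination: if $e, e' \in E$ satisfy $e \neq e'$ and $V(e) \subseteq V(e')$, then the rule removes $e'$, giving $\mathcal{H}' = (V',E',I')$ with $V' = V$, $E' = E \setminus \{e'\}$, $I' = \{(v,f) \in I : f \neq e'\}$. This is written $\mathcal{H} \to_{\text{edge}} \mathcal{H}'$. Node-domination: if $v, v' \in V$ satisfy $v \neq v'$ and $E(v) \subseteq E(v')$, then the rule removes $v$, giving $\mathcal{H}' = (V',E',I')$ with $V' = V \setminus \{v\}$, $E' = E$, $I' = \{(u,e) \in I : u \neq v\}$. This is written $\mathcal{H}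 \to_{\text{node}} \mathcal{H}'$. The relation $\to$ is the union of $\to_{\text{edge}}$ and $\to_{\text{node}}$, and $\to^*$ is the reflexive and transitive closure of $\to$. Two hypergraphs $\mathcal{H} = (V,E,I)$ and $\mathcal{H}' = (V',E',I')$ are isomorphic if there exist bijections $f \colon V' \to V$ and $g \colon E' \to E$ such that for all $v \in V'$ and $e \in E'$, $(v,e) \in I'$ if and only if $(f(v),g(e)) \in I$. -}

module Defs where

open import Level using (0ℓ) renaming (suc to lsuc)
open import Data.Nat.Base using (zero; suc)
open import Data.Fin.Base using (Fin; punchIn; punchOut)
open import Data.Fin.Properties
  using (punchInᵢ≢i; punchIn-punchOut; punchOut-punchIn; punchOut-cong; ¬Fin0)
open import Data.Product.Base using (Σ; ∃; _,_; proj₁)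
open import Data.Empty using (⊥-elim)
open import Function.Base using (_∘_)
open import Function.Bundles using (_↔_; _⤖_; _⇔_; Inverse; Bijection; mk↔ₛ′)
open import Relation.Binary.Core using (Rel; REL)
open import Relation.Binary.Construct.Union using (_∪_)
open import Relation.Binary.Construct.Closure.ReflexiveTransitive using (Star)
open import Relation.Binary.PropositionalEquality
  using (_≡_; _≢_; refl; sym; trans; cong)
open import Relation.Unary using (Pred; _⊆_)

Finite : Set → Set
Finite A = ∃ λ n → A ↔ Fin n

-- The set A \ {a}.  Since ⊥ is judgementally proof irrelevant, so is x ≢ a:
-- two elements of A ∖ a are equal as soon as their first components are.
infixl 6 _∖_
_∖_ : (A : Set) → A → Set
A ∖ a = Σ A (_≢ a)

private
  ∖-≡ : ∀ {A : Set} {a} {x y : A ∖ a} → proj₁ x ≡ proj₁ y → x ≡ y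
  ∖-≡ refl = refl

∖-finite : ∀ {A : Set} → Finite A → (a : A) → Finite (A ∖ a)
∖-finite (zero , A↔0) a = ⊥-elim (¬Fin0 (Inverse.to A↔0 a))
∖-finite {A} (suc n , A↔1+n) a = n , mk↔ₛ′ f g f∘g g∘f
  where
  open Inverse A↔1+n using (to; from; strictlyInverseˡ; strictlyInverseʳ)

  to-injective : ∀ {x y} → to x ≡ to y → x ≡ y
  to-injective {x} {y} eq =
    trans (sym (strictlyInverseʳ x)) (trans (cong from eq) (strictlyInverseʳ y))

  f : A ∖ a → Fin n
  f (x , x≢a) = punchOut {i = to a} {j = to x} (x≢a ∘ to-injective ∘ sym)

  g : Fin n → A ∖ a
  g i = from (punchIn (to a) i) ,
    λ eq → punchInᵢ≢i (to a) i (trans (sym (strictlyInverseˡ _)) (cong to eq))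

  f∘g : ∀ i → f (g i) ≡ i
  f∘g i = trans (punchOut-cong (to a) (strictlyInverseˡ _))
                (punchOut-punchIn (to a))

  g∘f : ∀ x → g (f x) ≡ x
  g∘f (x , x≢a) =
    ∖-≡ (trans (cong from (punchIn-punchOut (x≢a ∘ to-injective ∘ sym)))
               (strictlyInverseʳ x))

-- The incidence relation is arbitrary; in particular it is not required to be
-- decidable.  The enumerations witnessing finiteness carry no further meaning:
-- they play no role in the rules below or in isomorphism.
record Hypergraph : Set₁ where
  field
    V        : Set
    E        : Set
    V-finite : Finite V
    E-finite : Finite E
    I        : REL V E 0ℓ

open Hypergraph

edgesAt : (H : Hypergraph) → V H → Pred (E H) 0ℓ
edgesAt H v = λ e → I H v e

nodesOf : (H : Hypergraph) → E H → Pred (V H) 0ℓ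
nodesOf H e = λ v → I H v e

removeEdge : (H : Hypergraph) → E H → Hypergraph
removeEdge H e = record
  { V        = V H
  ; E        = E H ∖ e
  ; V-finite = V-finite H
  ; E-finite = ∖-finite (E-finite H) e
  ; I        = λ v f → I H v (proj₁ f)
  }

removeNode : (H : Hypergraph) → V H → Hypergraph
removeNode H v = record
  { V        = V H ∖ v
  ; E        = E H
  ; V-finite = ∖-finite (V-finite H) v
  ; E-finite = E-finite H
  ; I        = λ u e → I H (proj₁ u) e
  }

infix 4 _→edge_ _→node_ _⟶_ _⟶*_ _≅_

data _→edge_ (H : Hypergraph) : Hypergraph → Set where
  edge-domination : (e e′ : E H) → e ≢ e′ → nodesOf H e ⊆ nodesOf H e′ →
                    H →edge removeEdge H e′

data _→node_ (H : Hypergraph) : Hypergraph → Set where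
  node-domination : (v v′ : V H) → v ≢ v′ → edgesAt H v ⊆ edgesAt H v′ →
                    H →node removeNode H v

_⟶_ : Rel Hypergraph 0ℓ
_⟶_ = _→edge_ ∪ _→node_

_⟶*_ : Rel Hypergraph (lsuc 0ℓ)
_⟶*_ = Star _⟶_

_≅_ : Rel Hypergraph 0ℓ
H ≅ H′ =
  Σ (V H′ ⤖ V H) λ f →
  Σ (E H′ ⤖ E H) λ g →
  ∀ v e → I H′ v e ⇔ I H (Bijection.to f v) (Bijection.to g e)

{-# OPTIONS --safe #-}

-- Two steps out of a hypergraph can be closed by at most one step on each
-- side, up to isomorphism.  An edge step and a node step commute outright.
-- For two steps of the same kind, removing x (dominated by x′) and y (dominated
-- by y′), each removal survives the other unless domination chains close up:
-- if x′ is y, then transitivity lets y′ replace it, which fails only when y′ is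
-- x.  In that case x and y are twins, and removing one or the other gives
-- isomorphic hypergraphs.  As isomorphisms transport steps, this diamond
-- property tiles to confluence modulo isomorphism; termination is not needed.
module Submission where

open import Defs
open import Data.Fin.Properties using (inj⇒≟)
open import Data.Product.Base using (∃; ∃₂; _×_; _,_; proj₁)
open import Data.Sum.Base using (_⊎_; inj₁; inj₂)
open import Function.Base using (_∘_; flip)
open import Function.Bundles
  using (_↔_; _⇔_; Inverse; Equivalence; Injection; mk↔ₛ′; mk⇔)
open import Function.Construct.Identity using (⇔-id)
open import Function.Construct.Symmetry using (⇔-sym)
open import Function.Construct.Composition using (_⇔-∘_)
open import Function.Properties.Inverse
  using (↔-refl; ↔-sym; ↔-trans; ↔⇒⤖; ↔⇒↣)
open import Level using (0ℓ)
open import Relation.Binary.Construct.Closure.Reflexive as Refl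
  using (ReflClosure; [_])
open import Relation.Binary.Construct.Closure.ReflexiveTransitive
  using (Star; ε; _◅_; _◅◅_)
open import Relation.Binary.Core using (Rel)
open import Relation.Binary.Definitions
  using (DecidableEquality; Reflexive; Symmetric; Transitive)
open import Relation.Binary.PropositionalEquality
  using (_≡_; _≢_; refl; sym; trans; cong; subst; subst₂; ≢-sym)
open import Relation.Nullary.Decidable using (yes; no)
open import Relation.Nullary.Negation using (contradiction)
open import Relation.Unary using (Pred; _⊆_)

open Hypergraph

-- Abstract rewriting modulo an equivalence.

module ConfluenceModulo
  {a ℓ r} {A : Set a} {_⟶₁_ : Rel A ℓ} {_≈_ : Rel A r}
  (≈-refl : Reflexive _≈_) (≈-sym : Symmetric _≈_) (≈-trans : Transitive _≈_)
  (simulate : ∀ {x y x′} → x ≈ y → x ⟶₁ x′ → ∃ λ y′ → y ⟶₁ y′ × x′ ≈ y′)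
  (diamond : ∀ {x y z} → x ⟶₁ y → x ⟶₁ z → ∃₂ λ y′ z′ →
             ReflClosure _⟶₁_ y y′ × ReflClosure _⟶₁_ z z′ × y′ ≈ z′)
  where

  private
    _⟶?_ = ReflClosure _⟶₁_
    _↠_ = Star _⟶₁_

    ?⇒* : ∀ {x y} → x ⟶? y → x ↠ y
    ?⇒* Refl.refl = ε
    ?⇒* [ s ]     = s ◅ ε

  simulate* : ∀ {x y x′} → x ≈ y → x ↠ x′ → ∃ λ y′ → y ↠ y′ × x′ ≈ y′
  simulate* x≈y ε        = _ , ε , x≈y
  simulate* x≈y (s ◅ ss) =
    let _ , t , x₁≈y₁ = simulate x≈y s
        _ , ts , x′≈y′ = simulate* x₁≈y₁ ss
    in _ , t ◅ ts , x′≈y′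

  diamond? : ∀ {x y z} → x ⟶? y → x ⟶₁ z → ∃₂ λ y′ z′ →
             y ⟶? y′ × z ⟶? z′ × y′ ≈ z′
  diamond? Refl.refl t = _ , _ , [ t ] , Refl.refl , ≈-refl
  diamond? [ s ]     t = diamond s t

  -- Since `diamond` closes in at most one step on each side, a single step never grows while it is
  -- pushed along the sequence, so induction on the sequence suffices.
  strip : ∀ {x y z} → x ⟶? y → x ↠ z → ∃₂ λ y′ z′ →
          y ↠ y′ × z ⟶? z′ × y′ ≈ z′
  strip s ε        = _ , _ , ε , s , ≈-refl
  strip s (t ◅ ts) =
    let _ , _ , y⟶p , z₁⟶q , p≈q = diamond? s t
        _ , _ , q↠q′ , z⟶z′ , q′≈z′ = strip z₁⟶q ts
        -- The recursive path starts at `q`, but `y` only reaches `p`; the path is replayed from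
        -- there.
        _ , p↠p′ , q′≈p′ = simulate* (≈-sym p≈q) q↠q′
    in _ , _ , ?⇒* y⟶p ◅◅ p↠p′ , z⟶z′ , ≈-trans (≈-sym q′≈p′) q′≈z′

  confluent : ∀ {x y z} → x ↠ y → x ↠ z → ∃₂ λ y′ z′ →
              y ↠ y′ × z ↠ z′ × y′ ≈ z′
  confluent ε        ts = _ , _ , ts , ε , ≈-refl
  confluent (s ◅ ss) ts =
    let _ , _ , y₁↠p , z⟶q , p≈q = strip [ s ] ts
        _ , _ , y↠y′ , p↠p′ , y′≈p′ = confluent ss y₁↠p
        _ , q↠q′ , p′≈q′ = simulate* p≈q p↠p′
    in _ , _ , y↠y′ , ?⇒* z⟶q ◅◅ q↠q′ , ≈-trans y′≈p′ p′≈q′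

-- Bijections between sets with elements removed.

∖-≡ : ∀ {X : Set} {a} {x y : X ∖ a} → proj₁ x ≡ proj₁ y → x ≡ y
∖-≡ refl = refl

∖-cong : ∀ {X Y : Set} (f : X ↔ Y) (a : X) → (X ∖ a) ↔ (Y ∖ Inverse.to f a)
∖-cong f a = mk↔ₛ′
  (λ (x , x≢a) → to x , x≢a ∘ Injection.injective (↔⇒↣ f))
  (λ (y , y≢) → from y ,
    λ eq → y≢ (trans (sym (strictlyInverseˡ y)) (cong to eq)))
  (λ _ → ∖-≡ (strictlyInverseˡ _))
  (λ _ → ∖-≡ (strictlyInverseʳ _))
  where open Inverse f

∖-comm : ∀ {X : Set} {a b : X} {b≢a : b ≢ a} {a≢b : a ≢ b} →
         (X ∖ a ∖ (b , b≢a)) ↔ (X ∖ b ∖ (a , a≢b))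
-- The round trips alter only proofs of `≢`, which are definitionally equal.
∖-comm = mk↔ₛ′ exchange exchange (λ _ → refl) (λ _ → refl)
  where
  exchange : ∀ {X : Set} {a b : X} {b≢a : b ≢ a} {a≢b : a ≢ b} →
             X ∖ a ∖ (b , b≢a) → X ∖ b ∖ (a , a≢b)
  exchange ((x , x≢a) , x≢b) = (x , x≢b ∘ ∖-≡) , x≢a ∘ cong proj₁

module Replacement {X : Set} (_≟_ : DecidableEquality X) where

  -- The transposition of `a` and `b`, restricted to the complement of `a`.
  replace : ∀ {a b} → a ≢ b → X ∖ a → X ∖ b
  replace {a} {b} a≢b (x , _) with x ≟ b
  ... | yes _  = a , a≢b
  ... | no x≢b = x , x≢b

  replace-inverse : ∀ {a b} (a≢b : a ≢ b) (b≢a : b ≢ a) x →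
                    replace b≢a (replace a≢b x) ≡ x
  replace-inverse {a} {b} a≢b b≢a (x , x≢a) with x ≟ b
  replace-inverse {a} {b} a≢b b≢a (x , x≢a) | yes x≡b with a ≟ a
  ... | yes _  = ∖-≡ (sym x≡b)
  ... | no a≢a = contradiction refl a≢a
  replace-inverse {a} {b} a≢b b≢a (x , x≢a) | no _ with x ≟ a
  ... | yes x≡a = contradiction x≡a x≢a
  ... | no _    = refl

  replace-↔ : ∀ {a b} → a ≢ b → (X ∖ a) ↔ (X ∖ b)
  replace-↔ a≢b = mk↔ₛ′ (replace a≢b) (replace (≢-sym a≢b))
    (replace-inverse (≢-sym a≢b) a≢b) (replace-inverse a≢b (≢-sym a≢b))

  replace-resp : ∀ {a b} (a≢b : a ≢ b) (P : Pred X 0ℓ) → P a ⇔ P b →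
                 ∀ x → P (proj₁ x) ⇔ P (proj₁ (replace a≢b x))
  replace-resp {a} {b} a≢b P Pa⇔Pb (x , _) with x ≟ b
  ... | yes refl = ⇔-sym Pa⇔Pb
  ... | no _     = ⇔-id _

-- Pairs of dominated elements in a preorder-like relation.

module Domination {X : Set} (_≟_ : DecidableEquality X)
                  {_≲_ : Rel X 0ℓ} (≲-trans : Transitive _≲_) where

  Dominated : X → Set
  Dominated x = ∃ λ y → x ≢ y × x ≲ y

  -- The condition `y ≢ z` makes the domination of `x` survive the removal of `z`.
  DominatedOff : X → X → Set
  DominatedOff z x = ∃ λ y → y ≢ z × x ≢ y × x ≲ y

  dominatedOff-or-twin : ∀ {a b} → Dominated a → Dominated b → a ≢ b →
                         DominatedOff b a ⊎ (a ≲ b × b ≲ a)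
  dominatedOff-or-twin {a} {b} (a′ , a≢a′ , a≲a′) (b′ , b≢b′ , b≲b′) a≢b
    with a′ ≟ b | b′ ≟ a
  ... | no a′≢b  | _        = inj₁ (a′ , a′≢b , a≢a′ , a≲a′)
  ... | yes refl | yes refl = inj₂ (a≲a′ , b≲b′)
  ... | yes refl | no b′≢a  = inj₁ (b′ , ≢-sym b≢b′ , ≢-sym b′≢a , ≲-trans a≲a′ b≲b′)

  data Pair (a b : X) : Set where
    same        : a ≡ b → Pair a b
    twins       : a ≢ b → a ≲ b → b ≲ a → Pair a b
    independent : a ≢ b → DominatedOff b a → DominatedOff a b → Pair a b

  compare : ∀ {a b} → Dominated a → Dominated b → Pair a b
  compare {a} {b} da db with a ≟ b
  ... | yes a≡b = same a≡b
  ... | no a≢b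
    -- The dichotomy protects one element at a time, so it is applied in both directions.
    with dominatedOff-or-twin da db a≢b | dominatedOff-or-twin db da (≢-sym a≢b)
  ...   | inj₂ (a≲b , b≲a) | _                = twins a≢b a≲b b≲a
  ...   | inj₁ _           | inj₂ (b≲a , a≲b) = twins a≢b a≲b b≲a
  ...   | inj₁ da′         | inj₁ db′         = independent a≢b da′ db′

-- Isomorphisms and the transport of steps.

infix 4 _≃_
-- Explicit inverses make symmetry and the transport of inclusions direct; `≃⇒≅` returns to plain
-- bijections.
record _≃_ (H K : Hypergraph) : Set where
  field
    nodes     : V H ↔ V K
    edges     : E H ↔ E K
    incidence : ∀ v e → I H v e ⇔ I K (Inverse.to nodes v) (Inverse.to edges e)

open _≃_

≃-refl : Reflexive _≃_
≃-refl = record { nodes = ↔-refl ; edges = ↔-refl ; incidence = λ _ _ → ⇔-id _ }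

≃-sym : Symmetric _≃_
≃-sym {H} {K} h = record
  { nodes     = ↔-sym (nodes h)
  ; edges     = ↔-sym (edges h)
  ; incidence = λ v e → ⇔-sym (subst₂ (λ v′ e′ → I H (f.from v) (g.from e) ⇔ I K v′ e′)
      (f.strictlyInverseˡ v) (g.strictlyInverseˡ e)
      (incidence h (f.from v) (g.from e)))
  }
  where
  module f = Inverse (nodes h)
  module g = Inverse (edges h)

≃-trans : Transitive _≃_
≃-trans h k = record
  { nodes     = ↔-trans (nodes h) (nodes k)
  ; edges     = ↔-trans (edges h) (edges k)
  ; incidence = λ v e → incidence k _ _ ⇔-∘ incidence h v e
  }

≃⇒≅ : ∀ {H K} → H ≃ K → H ≅ K
≃⇒≅ h = ↔⇒⤖ (nodes k) , ↔⇒⤖ (edges k) , incidence k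
  -- The maps in `H ≅ K` run from `K` to `H`, hence the inversion.
  where k = ≃-sym h

≃-simulates-⟶ : ∀ {H K H′} → H ≃ K → H ⟶ H′ → ∃ λ K′ → K ⟶ K′ × H′ ≃ K′
≃-simulates-⟶ {H} {K} h (inj₁ (edge-domination e e′ e≢e′ e⊆e′)) =
  removeEdge K (g.to e′) ,
  inj₁ (edge-domination (g.to e) (g.to e′) (e≢e′ ∘ Injection.injective (↔⇒↣ (edges h))) ge⊆ge′) ,
  record
    { nodes     = nodes h
    ; edges     = ∖-cong (edges h) e′
    ; incidence = λ v f → incidence h v (proj₁ f)
    }
  where
  module f = Inverse (nodes h)
  module g = Inverse (edges h)
  ge⊆ge′ : nodesOf K (g.to e) ⊆ nodesOf K (g.to e′)
  -- Every node of `K` is the image of its preimage, where the inclusion in `H` applies.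
  ge⊆ge′ {v} = subst (λ u → I K u (g.to e) → I K u (g.to e′)) (f.strictlyInverseˡ v)
    (Equivalence.to (incidence h _ e′) ∘ e⊆e′ ∘ Equivalence.from (incidence h _ e))
≃-simulates-⟶ {H} {K} h (inj₂ (node-domination v v′ v≢v′ v⊆v′)) =
  removeNode K (f.to v) ,
  inj₂ (node-domination (f.to v) (f.to v′) (v≢v′ ∘ Injection.injective (↔⇒↣ (nodes h))) fv⊆fv′) ,
  record
    { nodes     = ∖-cong (nodes h) v
    ; edges     = edges h
    ; incidence = λ u e → incidence h (proj₁ u) e
    }
  where
  module g = Inverse (edges h)
  module f = Inverse (nodes h)
  fv⊆fv′ : edgesAt K (f.to v) ⊆ edgesAt K (f.to v′)
  fv⊆fv′ {e} = subst (λ d → I K (f.to v) d → I K (f.to v′) d) (g.strictlyInverseˡ e)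
    (Equivalence.to (incidence h v′ _) ∘ v⊆v′ ∘ Equivalence.from (incidence h v _))

-- The diamond property of the two rules.

finite⇒≟ : ∀ {X} → Finite X → DecidableEquality X
finite⇒≟ (_ , X↔Fin) = inj⇒≟ (↔⇒↣ X↔Fin)

Joinable : Rel Hypergraph _
Joinable A B = ∃₂ λ A′ B′ → ReflClosure _⟶_ A A′ × ReflClosure _⟶_ B B′ × A′ ≃ B′

joinable-edge-edge : ∀ {H A B} → H →edge A → H →edge B → Joinable A B
joinable-edge-edge {H}
  (edge-domination a′ a a′≢a a′⊆a) (edge-domination b′ b b′≢b b′⊆b)
  with compare (a′ , ≢-sym a′≢a , λ {_} → a′⊆a) (b′ , ≢-sym b′≢b , λ {_} → b′⊆b)
  where
  open Domination (finite⇒≟ (E-finite H))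
    -- Edge-domination removes the larger edge, so the order is reverse inclusion.
    {_≲_ = λ e e′ → nodesOf H e′ ⊆ nodesOf H e} (λ p q {_} → p ∘ q)
... | Domination.same refl = _ , _ , Refl.refl , Refl.refl , ≃-refl
... | Domination.twins a≢b b⊆a a⊆b = _ , _ , Refl.refl , Refl.refl , record
  { nodes     = ↔-refl
  ; edges     = replace-↔ a≢b
  ; incidence = λ v → replace-resp a≢b (I H v) (mk⇔ a⊆b b⊆a)
  }
  where open Replacement (finite⇒≟ (E-finite H))
... | Domination.independent a≢b (c , c≢b , a≢c , c⊆a) (d , d≢a , b≢d , d⊆b) =
  _ , _ ,
  -- The edge `d` is still present once `a` is gone and so justifies removing `b`; `c` does the same
  -- for `a` on the other side.
  [ inj₁ (edge-domination (d , d≢a) (b , ≢-sym a≢b) (≢-sym b≢d ∘ cong proj₁) d⊆b) ] ,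
  [ inj₁ (edge-domination (c , c≢b) (a , a≢b) (≢-sym a≢c ∘ cong proj₁) c⊆a) ] ,
  record { nodes = ↔-refl ; edges = ∖-comm ; incidence = λ _ _ → ⇔-id _ }

joinable-node-node : ∀ {H A B} → H →node A → H →node B → Joinable A B
joinable-node-node {H}
  (node-domination a a′ a≢a′ a⊆a′) (node-domination b b′ b≢b′ b⊆b′)
  with compare (a′ , a≢a′ , λ {_} → a⊆a′) (b′ , b≢b′ , λ {_} → b⊆b′)
  where
  open Domination (finite⇒≟ (V-finite H))
    {_≲_ = λ v v′ → edgesAt H v ⊆ edgesAt H v′} (λ p q {_} → q ∘ p)
... | Domination.same refl = _ , _ , Refl.refl , Refl.refl , ≃-refl
... | Domination.twins a≢b a⊆b b⊆a = _ , _ , Refl.refl , Refl.refl , record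
  { nodes     = replace-↔ a≢b
  ; edges     = ↔-refl
  ; incidence = λ v e → replace-resp a≢b (flip (I H) e) (mk⇔ a⊆b b⊆a) v
  }
  where open Replacement (finite⇒≟ (V-finite H))
... | Domination.independent a≢b (c , c≢b , a≢c , a⊆c) (d , d≢a , b≢d , b⊆d) =
  _ , _ ,
  [ inj₂ (node-domination (b , ≢-sym a≢b) (d , d≢a) (b≢d ∘ cong proj₁) b⊆d) ] ,
  [ inj₂ (node-domination (a , a≢b) (c , c≢b) (a≢c ∘ cong proj₁) a⊆c) ] ,
  record { nodes = ∖-comm ; edges = ↔-refl ; incidence = λ _ _ → ⇔-id _ }

-- Each inclusion restricts to the smaller hypergraph, and both orders of removal give
-- definitionally the same result.
joinable-edge-node : ∀ {H A B} → H →edge A → H →node B → Joinable A B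
joinable-edge-node (edge-domination e e′ e≢e′ e⊆e′) (node-domination v v′ v≢v′ v⊆v′) =
  _ , _ ,
  [ inj₂ (node-domination v v′ v≢v′ v⊆v′) ] ,
  [ inj₁ (edge-domination e e′ e≢e′ e⊆e′) ] ,
  ≃-refl

joinable-sym : Symmetric Joinable
joinable-sym (_ , _ , s , t , h) = _ , _ , t , s , ≃-sym h

⟶-diamond : ∀ {H A B} → H ⟶ A → H ⟶ B → Joinable A B
⟶-diamond (inj₁ s) (inj₁ t) = joinable-edge-edge s t
⟶-diamond (inj₁ s) (inj₂ t) = joinable-edge-node s t
⟶-diamond (inj₂ s) (inj₁ t) = joinable-sym (joinable-edge-node t s)
⟶-diamond (inj₂ s) (inj₂ t) = joinable-node-node s t

theorem1p1 : (H H₁ H₂ : Hypergraph) → H ⟶* H₁ → H ⟶* H₂ →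
    ∃₂ λ (H₁′ H₂′ : Hypergraph) → (H₁ ⟶* H₁′) × (H₂ ⟶* H₂′) × (H₁′ ≅ H₂′)
theorem1p1 H H₁ H₂ H⟶*H₁ H⟶*H₂ =
  let H₁′ , H₂′ , s , t , h = confluent H⟶*H₁ H⟶*H₂
  in H₁′ , H₂′ , s , t , ≃⇒≅ h
  where open ConfluenceModulo ≃-refl ≃-sym ≃-trans ≃-simulates-⟶ ⟶-diamond
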